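{- Let $X$ be a finite set with $|X|\ge 2$ and let $\mathbb{M}_X$ be the free monoid with basis $X$. Then every recursively enumerable language in the alphabet $X$, viewed as a subset of $\mathbb{M}_X$, is definable in $\mathbb{M}_X$ with parameters from $X$.
   Context: A subset $A\subseteq \mathbb{M}_X$ is definable with parameters from $X$ if there is a first-order formula $\phi(x)$ in the language of monoids, with constants for elements of $X$, such that $A=\{b\in\mathbb{M}_X : \mathbb{M}_X\models\phi(b)\}$. -}

module Defs where

open import Algebra.Bundles using (Monoid)
open import Data.Fin using (Fin)
open import Data.Fin.Subset using (Subset; _∈_)
open import Data.List using (List; []; _∷_; map)
open import Data.Maybe using (Maybe; just)
open import Data.Nat using (ℕ; suc)
open import Data.Product using (_×_; _,_; Σ; ∃-syntax)
open import Data.Sum using (_⊎_)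
open import Data.Vec using (Vec; lookup) renaming ([] to []ᵛ; _∷_ to _∷ᵛ_)
open import Function.Bundles using (_⇔_)
open import Level using (Level; _⊔_)
open import Relation.Binary.Construct.Closure.ReflexiveTransitive using (Star)
open import Relation.Binary.PropositionalEquality using (_≡_)
open import Relation.Nullary using (¬_)
open import Relation.Unary using (Pred)

private
  variable
    a : Level
    m : ℕ

infixl 10 _∙′_
infix  9 _≐_
infixr 8 ¬′_
infixr 7 _∧′_
infixr 6 _∨′_
infixr 5 _⇒′_
infixr 4 ∀′_ ∃′_

-- Terms and formulas have their free variables among m de Bruijn indices;
-- a quantifier binds index zero.

data Term (X : Set a) (m : ℕ) : Set a where
  var   : Fin m → Term X m
  const : X → Term X m
  ε′    : Term X m
  _∙′_  : Term X m → Term X m → Term X m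

-- Satisfaction below is interpreted in a constructive metatheory, where the
-- connectives and quantifiers are not interdefinable, so all are primitive.

data Formula (X : Set a) : ℕ → Set a where
  _≐_            : Term X m → Term X m → Formula X m
  ¬′_            : Formula X m → Formula X m
  _∧′_ _∨′_ _⇒′_ : Formula X m → Formula X m → Formula X m
  ∀′_ ∃′_        : Formula X (suc m) → Formula X m

module Semantics {a b} {X : Set b} (M : Monoid a a) (ι : X → Monoid.Carrier M) where

  open Monoid M

  ⟦_⟧ : Term X m → Vec Carrier m → Carrier
  ⟦ var i   ⟧ ρ = lookup ρ i
  ⟦ const x ⟧ ρ = ι x
  ⟦ ε′      ⟧ ρ = ε
  ⟦ s ∙′ t  ⟧ ρ = ⟦ s ⟧ ρ ∙ ⟦ t ⟧ ρ

  infix 3 _⊨_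

  _⊨_ : Vec Carrier m → Formula X m → Set a
  ρ ⊨ s ≐ t   = ⟦ s ⟧ ρ ≈ ⟦ t ⟧ ρ
  ρ ⊨ ¬′ φ    = ¬ (ρ ⊨ φ)
  ρ ⊨ φ ∧′ ψ  = (ρ ⊨ φ) × (ρ ⊨ ψ)
  ρ ⊨ φ ∨′ ψ  = (ρ ⊨ φ) ⊎ (ρ ⊨ ψ)
  ρ ⊨ φ ⇒′ ψ  = (ρ ⊨ φ) → (ρ ⊨ ψ)
  ρ ⊨ ∀′ φ    = ∀ b → (b ∷ᵛ ρ) ⊨ φ
  ρ ⊨ ∃′ φ    = Σ Carrier λ b → (b ∷ᵛ ρ) ⊨ φ

Definable : ∀ {a b ℓ} {X : Set b} (M : Monoid a a) (ι : X → Monoid.Carrier M) →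
            Pred (Monoid.Carrier M) ℓ → Set (a ⊔ b ⊔ ℓ)
Definable {X = X} M ι A =
  Σ (Formula X 1) λ φ → ∀ b → A b ⇔ ((b ∷ᵛ []ᵛ) ⊨ φ)
  where open Semantics M ι

-- The tape alphabet of a machine with input alphabet X: the blank, the input
-- letters and k auxiliary letters.

data Symbol (X : Set a) (k : ℕ) : Set a where
  blank : Symbol X k
  input : X → Symbol X k
  aux   : Fin k → Symbol X k

data Direction : Set where
  left right : Direction

-- Deterministic machines with a single two-way infinite tape; the machine
-- halts where δ is undefined.

record TuringMachine (X : Set a) : Set a where
  field
    states    : ℕ
    auxiliary : ℕ

  State : Set
  State = Fin states

  Letter : Set a
  Letter = Symbol X auxiliary

  field
    δ         : State → Letter → Maybe (State × Letter × Direction)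
    start     : State
    accepting : Subset states

  -- In  ⟨ q ∣ ls , s , rs ⟩  the head reads s, and ls and rs list the cells to
  -- its left and to its right, nearest first; all further cells are blank.

  data Config : Set a where
    ⟨_∣_,_,_⟩ : State → List Letter → Letter → List Letter → Config

  move : Direction → State → List Letter → Letter → List Letter → Config
  move left  q []       s rs       = ⟨ q ∣ []     , blank , s ∷ rs ⟩
  move left  q (l ∷ ls) s rs       = ⟨ q ∣ ls     , l     , s ∷ rs ⟩
  move right q ls       s []       = ⟨ q ∣ s ∷ ls , blank , []     ⟩
  move right q ls       s (r ∷ rs) = ⟨ q ∣ s ∷ ls , r     , rs     ⟩

  infix 4 _⟶_

  data _⟶_ : Config → Config → Set a where
    step : ∀ {q ls s rs q′ s′ d} → δ q s ≡ just (q′ , s′ , d) →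
           ⟨ q ∣ ls , s , rs ⟩ ⟶ move d q′ ls s′ rs

  initial : List X → Config
  initial []      = ⟨ start ∣ [] , blank   , []          ⟩
  initial (x ∷ w) = ⟨ start ∣ [] , input x , map input w ⟩

  Accepts : List X → Set a
  Accepts w = ∃[ q ] ∃[ ls ] ∃[ s ] ∃[ rs ]
    (Star _⟶_ (initial w) ⟨ q ∣ ls , s , rs ⟩ × q ∈ accepting)

RecursivelyEnumerable : ∀ {a ℓ} {X : Set a} → Pred (List X) ℓ → Set (a ⊔ ℓ)
RecursivelyEnumerable {X = X} L =
  Σ (TuringMachine X) λ T → ∀ w → L w ⇔ TuringMachine.Accepts T w

{-# OPTIONS --safe #-}
module Submission where

-- A configuration is coded by three words, joined by βt′ into an entry e, and a
-- computation by one word h in which consecutive entries are separated by βt.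
-- The formula asserts, for some t, t′ and h, that h starts with the initial
-- configuration and that every entry in h is accepting or is followed by a
-- successor. Since h is finite, following it from its start yields an accepting
-- run, whatever t and t′ are. Only to build h from a given run must its parsing
-- be unique, and there t and t′ are at our disposal: powers of α longer than
-- anything they separate, where α ≠ β.

open import Defs
open import Data.Empty using (⊥-elim)
open import Data.Fin using (Fin; zero; suc; toℕ; _↑ʳ_; #_)
open import Data.Fin.Properties using (toℕ-injective)
open import Data.Fin.Subset using (_∈_)
open import Data.Fin.Subset.Properties using (_∈?_)
open import Data.List using (List; [_]; []; _∷_; _++_; map; length; replicate; foldr; lookup; allFin)
open import Data.List.Membership.Propositional using () renaming (_∈_ to _∈ˡ_)
open import Data.List.Membership.Propositional.Properties
  using (∈-map⁺; ∈-++⁺ˡ; ∈-++⁺ʳ; ∈-allFin)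
open import Data.List.Properties
  using (++-monoid; ++-assoc; ++-identityʳ; ++-cancelˡ; length-++; length-replicate; ∷-injective; ∷-injectiveʳ)
open import Data.List.Relation.Unary.Any using (here; there; index)
open import Data.List.Relation.Unary.Any.Properties using (lookup-index)
open import Data.Maybe using (Maybe; just; nothing)
open import Data.Nat using (ℕ; zero; suc; _+_; _≤_; _<_; s≤s)
open import Data.Nat.Properties
  using (≤-trans; ≤-refl; <⇒≱; m≤m+n; m≤n+m; module ≤-Reasoning)
open import Data.Product using (_×_; _,_; Σ; proj₁; proj₂)
open import Data.Sum using (inj₁; inj₂)
open import Data.Vec using (Vec) renaming (lookup to lookupᵛ; [] to []ᵛ; _∷_ to _∷ᵛ_)
open import Function.Bundles using (_↔_; _⇔_; mk⇔; Inverse; Equivalence)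
open import Function.Construct.Composition using (_⇔-∘_)
open import Level using (Level)
open import Relation.Binary.Construct.Closure.ReflexiveTransitive using (Star; ε; _◅_)
open import Relation.Binary.PropositionalEquality
  using (_≡_; _≢_; refl; sym; trans; cong; subst)
open import Relation.Nullary using (¬_; yes; no)
open import Relation.Unary using (Pred)

private
  variable
    a : Level
    m : ℕ

-- Enumerations of states and tape symbols.

record Enumeration (A : Set a) : Set a where
  field
    elements : List A
    complete : ∀ x → x ∈ˡ elements

  position : A → ℕ
  position x = toℕ (index (complete x))

  -- Looking the index up in `elements` returns the element itself, so distinct elements have
  -- distinct positions even in a list with repetitions.
  position-injective : ∀ {x y} → position x ≡ position y → x ≡ y
  position-injective {x} {y} eq = trans (lookup-index (complete x))
    (trans (cong (lookup elements) (toℕ-injective eq)) (sym (lookup-index (complete y))))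

open Enumeration

finEnumeration : ∀ n → Enumeration (Fin n)
finEnumeration n = record { elements = allFin n ; complete = ∈-allFin }

module _ {X : Set a} {n : ℕ} (X↔Fin : X ↔ Fin n) where
  open Inverse X↔Fin

  symbolEnumeration : ∀ k → Enumeration (Symbol X k)
  symbolEnumeration k = record { elements = blank ∷ inputs ++ auxs ; complete = member }
    where
    inputs auxs : List (Symbol X k)
    inputs = map (λ i → input (from i)) (allFin n)
    auxs   = map aux (allFin k)

    member : ∀ s → s ∈ˡ blank ∷ inputs ++ auxs
    member blank     = here refl
    member (input x) = there (∈-++⁺ˡ (subst (λ y → input y ∈ˡ inputs) (strictlyInverseʳ x)
                                        (∈-map⁺ (λ i → input (from i)) (∈-allFin (to x)))))
    member (aux i)   = there (∈-++⁺ʳ inputs (∈-map⁺ aux (∈-allFin i)))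

-- Words, powers of `α` and separators.

module FreeMonoid {X : Set a} {α β : X} (α≢β : α ≢ β) where

  open Semantics (++-monoid X) [_]

  Word : Set a
  Word = List X

  Free : Word → Word → Set a
  Free t w = ¬ (Σ Word λ p → Σ Word λ q → w ≡ p ++ (t ++ q))

  infixr 5 _⟨_⟩_

  -- The `β` keeps letters `α` at the end of `u` from merging with a power `t`, so that the
  -- separator has a definite start.
  _⟨_⟩_ : Word → Word → Word → Word
  u ⟨ t ⟩ v = u ++ β ∷ t ++ v

  power : ℕ → Word
  power i = replicate i α

  Free-tail : ∀ {t x w} → Free t (x ∷ w) → Free t w
  Free-tail {x = x} free (p , q , eq) = free (x ∷ p , q , cong (x ∷_) eq)

  short⇒Free : ∀ {i w} → length w < i → Free (power i) w
  short⇒Free {i} {w} w<i (p , q , eq) = <⇒≱ w<i (begin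
    i                                     ≡⟨ length-replicate i ⟨
    length (power i)                      ≤⟨ m≤m+n _ _ ⟩
    length (power i) + length q           ≡⟨ length-++ (power i) ⟨
    length (power i ++ q)                 ≤⟨ m≤n+m _ _ ⟩
    length p + length (power i ++ q)      ≡⟨ length-++ p ⟨
    length (p ++ power i ++ q)            ≡⟨ cong length eq ⟨
    length w                              ∎)
    where open ≤-Reasoning

  -- The displayed `β` cannot lie among the first `i` letters, which are all `α`.
  power-prefix : ∀ i {u e v} → power i ++ u ≡ e ++ β ∷ v →
                 Σ Word λ e′ → e ≡ power i ++ e′ × u ≡ e′ ++ β ∷ v
  power-prefix zero    {e = e}     eq = e , refl , eq
  power-prefix (suc i) {e = []}    eq = ⊥-elim (α≢β (proj₁ (∷-injective eq)))
  power-prefix (suc i) {e = x ∷ e} eq with ∷-injective eq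
  ... | refl , eq′ with power-prefix i eq′
  ...   | e′ , refl , eq″ = e′ , refl , eq″

  -- If the separator after `p` started inside `e`, its `power i` would have to end before the `β`
  -- that follows `e`, hence lie inside `e`, against freeness.
  separator-split : ∀ i e {p u v} → Free (power i) e →
                    e ⟨ power i ⟩ u ≡ p ⟨ power i ⟩ v →
                    Σ Word λ p′ → p ≡ e ++ p′ × [] ⟨ power i ⟩ u ≡ p′ ⟨ power i ⟩ v
  separator-split i []      {p}     free eq = p , refl , eq
  separator-split i (x ∷ e) {[]}    free eq with power-prefix i (sym (proj₂ (∷-injective eq)))
  ... | e′ , refl , _ = ⊥-elim (free ([ x ] , e′ , refl))
  separator-split i (x ∷ e) {y ∷ p} free eq with ∷-injective eq
  ... | refl , eq′ with separator-split i e (Free-tail free) eq′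
  ...   | p′ , refl , eq″ = p′ , refl , eq″

  -- By `separator-split`, `e′` extends `e`; a proper extension would swallow the whole separator
  -- after `e`, including its `power i`.
  separator-unique : ∀ i {e e′ u v} → Free (power i) e → Free (power i) e′ →
                     e ⟨ power i ⟩ u ≡ e′ ⟨ power i ⟩ v → e ≡ e′ × u ≡ v
  separator-unique i {e} {u = u} {v} free free′ eq with separator-split i e free eq
  ... | []    , refl , eq′ = sym (++-identityʳ e) , ++-cancelˡ (power i) u v (∷-injectiveʳ eq′)
  ... | x ∷ p , refl , eq′ with power-prefix i (∷-injectiveʳ eq′)
  ...   | p′ , refl , _ = ⊥-elim (free′ (e ++ [ x ] , p′ , sym (++-assoc e [ x ] _)))

  letter-occurs : ∀ (u : Word) {x v} → [] ≢ u ++ x ∷ v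
  letter-occurs []      ()
  letter-occurs (_ ∷ _) ()

  -- There is one `β` on the left and there are at least two on the right.
  separator-once : ∀ i p u {v} → [] ⟨ power i ⟩ [] ≢ p ⟨ power i ⟩ u ⟨ power i ⟩ v
  separator-once i []      u eq = letter-occurs u (++-cancelˡ (β ∷ power i) _ _ eq)
  separator-once i (x ∷ p) u eq with power-prefix i (∷-injectiveʳ eq)
  ... | p′ , _ , eq′ = letter-occurs p′ eq′

  suffix-shorter : ∀ u {t} v → length v < length (u ⟨ t ⟩ v)
  suffix-shorter u {t} v = begin
    suc (length v)                  ≤⟨ s≤s (m≤n+m _ _) ⟩
    suc (length t + length v)       ≡⟨ cong suc (length-++ t) ⟨
    length (β ∷ t ++ v)             ≤⟨ m≤n+m _ _ ⟩
    length u + length (β ∷ t ++ v)  ≡⟨ length-++ u ⟨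
    length (u ⟨ t ⟩ v)              ∎
    where open ≤-Reasoning

  -- Entries and the formulas that recognize them.

  Triple : Set a
  Triple = Word × Word × Word

  second third : Triple → Word
  second (_ , y , _) = y
  third  (_ , _ , z) = z

  join : Word → Triple → Word
  join t (x , y , z) = x ⟨ t ⟩ y ⟨ t ⟩ z

  -- Freeness from `t` delimits the entry within a history. Freeness of `x` and `y` from `t′`
  -- locates the two inner separators, and `z` is what remains.
  Entry : (t t′ e : Word) → Triple → Set a
  Entry t t′ e (x , y , z) = Free t e × Free t′ x × Free t′ y × e ≡ join t′ (x , y , z)

  Entry-unique : ∀ {t e x x′} i → Entry t (power i) e x → Entry t (power i) e x′ → x ≡ x′
  Entry-unique i (_ , fx , fy , refl) (_ , fx′ , fy′ , eq)
    with separator-unique i fx fx′ eq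
  ... | refl , eq′ with separator-unique i fy fy′ eq′
  ...   | refl , refl = refl

  -- Formulas are written as functions of the variables they speak about, so
  -- that weakening is an index shift and satisfaction needs no transport.

  Vars : ℕ → Set
  Vars m = Fin m × Fin m × Fin m

  infixr 6 _↑_

  _↑_ : ∀ k → Vars m → Vars (k + m)
  k ↑ (i , j , l) = k ↑ʳ i , k ↑ʳ j , k ↑ʳ l

  values : Vec Word m → Vars m → Triple
  values ρ (i , j , l) = lookupᵛ ρ i , lookupᵛ ρ j , lookupᵛ ρ l

  infixr 10 _⟨_⟩′_

  -- Bracketed so that its value is `_⟨_⟩_` by computation.
  _⟨_⟩′_ : Term X m → Fin m → Term X m → Term X m
  u ⟨ t ⟩′ v = u ∙′ (const β ∙′ (var t ∙′ v))

  free′ : Fin m → Fin m → Formula X m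
  free′ t w = ¬′ (∃′ ∃′ (var (2 ↑ʳ w) ≐ var (# 1) ∙′ (var (2 ↑ʳ t) ∙′ var (# 0))))

  entry′ : (t t′ e : Fin m) → Vars m → Formula X m
  entry′ t t′ e (x , y , z) =
    free′ t e ∧′ free′ t′ x ∧′ free′ t′ y ∧′ (var e ≐ var x ⟨ t′ ⟩′ var y ⟨ t′ ⟩′ var z)

  -- Definability of reachability in a transition system.

  module Reachability
    {C : Set a} (_⇝_ : C → C → Set a) (Final : C → Set) (encode : C → Triple)
    (step′  : ∀ {m} → Vars m → Vars m → Formula X m)
    (final′ : ∀ {m} → Vars m → Formula X m)
    -- Words that satisfy `step′` after a code are again a code, so validity of codes passes along a
    -- history without a formula of its own.
    (step-⇔  : ∀ {m} (ρ : Vec Word m) xs ys {c} → values ρ xs ≡ encode c →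
               (ρ ⊨ step′ xs ys) ⇔ (Σ C λ d → values ρ ys ≡ encode d × c ⇝ d))
    (final-⇔ : ∀ {m} (ρ : Vec Word m) xs {c} → values ρ xs ≡ encode c →
               (ρ ⊨ final′ xs) ⇔ Final c)
    where

    Reaches : C → Set a
    Reaches c = Σ C λ d → Star _⇝_ c d × Final d

    -- Bound, from the outside: the next entry, the rest of the history after it,
    -- and the three words of that entry.

    continue′ : (t t′ r : Fin m) → Vars m → Formula X m
    continue′ t t′ r xs =
      final′ xs ∨′
      (∃′ ∃′ ∃′ ∃′ ∃′
        ((var (5 ↑ʳ r) ≐ var (# 4) ⟨ 5 ↑ʳ t ⟩′ var (# 3)) ∧′
         entry′ (5 ↑ʳ t) (5 ↑ʳ t′) (# 4) (# 2 , # 1 , # 0) ∧′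
         step′ (5 ↑ xs) (# 2 , # 1 , # 0)))

    -- Bound, from the outside: the part of h before an entry, the entry, the part
    -- after it, and its three words.

    history′ : (t t′ h : Fin m) → Formula X m
    history′ t t′ h =
      ∀′ ∀′ ∀′ ∀′ ∀′ ∀′
        ((var (6 ↑ʳ h) ≐ var (# 5) ⟨ 6 ↑ʳ t ⟩′ var (# 4) ⟨ 6 ↑ʳ t ⟩′ var (# 3)) ⇒′
         entry′ (6 ↑ʳ t) (6 ↑ʳ t′) (# 4) (# 2 , # 1 , # 0) ⇒′
         continue′ (6 ↑ʳ t) (6 ↑ʳ t′) (# 3) (# 2 , # 1 , # 0))

    -- The word `h` opens with a separator, so that its first entry also stands between two
    -- separators, as in `history′`.
    reaches′ : Vars m → Formula X m
    reaches′ xs =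
      ∃′ ∃′ ∃′ ((∃′ ∃′ ((var (# 2) ≐ ε′ ⟨ # 4 ⟩′ var (# 1) ⟨ # 4 ⟩′ var (# 0)) ∧′
                        entry′ (# 4) (# 3) (# 1) (5 ↑ xs))) ∧′
                history′ (# 2) (# 1) (# 0))

    -- Induction on `k`, which bounds the part of `h` still ahead; passing to the next entry
    -- shortens that part.
    history⇒reaches : ∀ (ρ : Vec Word m) t t′ h → (ρ ⊨ history′ t t′ h) →
      ∀ k p e r c → length r < k →
      lookupᵛ ρ h ≡ p ⟨ lookupᵛ ρ t ⟩ e ⟨ lookupᵛ ρ t ⟩ r →
      Entry (lookupᵛ ρ t) (lookupᵛ ρ t′) e (encode c) → Reaches c
    history⇒reaches ρ t t′ h hist (suc k) p e r c (s≤s r≤k) split entry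
      with hist p e r _ _ _ split entry
    ... | inj₁ fin = c , ε , Equivalence.to (final-⇔ _ (# 2 , # 1 , # 0) refl) fin
    ... | inj₂ (e′ , r′ , x , y , z , refl , entry″ , stp)
      with Equivalence.to (step-⇔ _ (# 7 , # 6 , # 5) (# 2 , # 1 , # 0) refl) stp
    ... | d , refl , c⇝d
      with history⇒reaches ρ t t′ h hist k (p ⟨ lookupᵛ ρ t ⟩ e) e′ r′ d
             (≤-trans (suffix-shorter e′ r′) r≤k)
             (trans split (sym (trans (++-assoc p _ _)
               (cong (p ++_) (cong (β ∷_) (++-assoc (lookupᵛ ρ t) e _))))))
             entry″
    ... | d′ , run , fin = d′ , c⇝d ◅ run , fin

    -- The sum serves as a bound on `f` along the run: it dominates each term and does not grow on
    -- passing to a tail.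
    total : (C → ℕ) → ∀ {c d} → Star _⇝_ c d → ℕ
    total f {c} ε        = f c
    total f {c} (_ ◅ cs) = f c + total f cs

    head≤total : ∀ f {c d} (cs : Star _⇝_ c d) → f c ≤ total f cs
    head≤total f ε        = ≤-refl
    head≤total f (_ ◅ cs) = m≤m+n _ _

    total-tail : ∀ f {c d e} (s : c ⇝ d) (cs : Star _⇝_ d e) → total f cs ≤ total f (s ◅ cs)
    total-tail f s cs = m≤n+m _ _

    -- Measures the two components that `Entry` requires to be free of `t′`.
    size : C → ℕ
    size c = let (x , y , z) = encode c in length x + length y

    module Completeness (i j : ℕ) where

      entry : C → Word
      entry c = join (power j) (encode c)

      -- The first configuration is left out: the trace is what follows its entry and separator in
      -- the history.
      trace : ∀ {c d} → Star _⇝_ c d → Word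
      trace ε                    = []
      trace (_◅_ {j = c} _ cs) = entry c ⟨ power i ⟩ trace cs

      entry-valid : ∀ c → length (entry c) < i → size c < j →
                    Entry (power i) (power j) (entry c) (encode c)
      entry-valid c e<i s<j =
        short⇒Free e<i ,
        short⇒Free (≤-trans (s≤s (m≤m+n _ _)) s<j) ,
        short⇒Free (≤-trans (s≤s (m≤n+m _ _)) s<j) ,
        refl

      -- The intended parsing is the only one. If `p` is empty, `e` is the first entry; otherwise
      -- `p` contains the first separator and entry, and the claim reduces to the tail of the run.
      trace-continues : ∀ {c d} (cs : Star _⇝_ c d) → Final d →
        total (λ c → length (entry c)) cs < i → total size cs < j →
        ∀ (ρ : Vec Word m) t t′ r xs p e →
        lookupᵛ ρ t ≡ power i → lookupᵛ ρ t′ ≡ power j →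
        [] ⟨ power i ⟩ entry c ⟨ power i ⟩ trace cs ≡ p ⟨ power i ⟩ e ⟨ power i ⟩ lookupᵛ ρ r →
        Entry (power i) (power j) e (values ρ xs) →
        ρ ⊨ continue′ t t′ r xs
      trace-continues {c = c} cs fin pi pj ρ t t′ r xs [] e t≡ t′≡ split en@(fe , _)
        with entry-valid c (≤-trans (s≤s (head≤total _ cs)) pi) (≤-trans (s≤s (head≤total _ cs)) pj)
      ... | good@(fc , _)
        -- Both entries follow the same separator and are free of `power i`, hence they agree.
        with separator-unique i fc fe (++-cancelˡ (β ∷ power i) _ _ split)
      ... | refl , tr≡
        with Entry-unique j en good
      trace-continues ε fin pi pj ρ t t′ r xs [] e t≡ t′≡ split en | good | refl , tr≡ | xs≡ =
        inj₁ (Equivalence.from (final-⇔ ρ xs xs≡) fin)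
      trace-continues (_◅_ {j = c} s cs) fin pi pj ρ t t′ r xs [] e t≡ t′≡ split en | good | refl , tr≡ | xs≡
        rewrite t≡ | t′≡ =
        inj₂ (entry c , trace cs , _ , _ , _ , sym tr≡ ,
              entry-valid c (≤-trans (s≤s (≤-trans (head≤total _ cs) (total-tail _ s cs))) pi)
                           (≤-trans (s≤s (≤-trans (head≤total _ cs) (total-tail _ s cs))) pj) ,
              Equivalence.from (step-⇔ _ (5 ↑ xs) (# 2 , # 1 , # 0) xs≡) (c , refl , s))
      trace-continues {c = c} cs fin pi pj ρ t t′ r xs (x ∷ p) e t≡ t′≡ split en
        -- The separator after a nonempty `p` starts neither inside the first separator nor inside
        -- the first entry, so `p` contains both.
        with power-prefix i (∷-injectiveʳ split)
      ... | p₁ , refl , eq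
        with separator-split i (entry c) (proj₁ (entry-valid c
               (≤-trans (s≤s (head≤total _ cs)) pi) (≤-trans (s≤s (head≤total _ cs)) pj))) eq
      -- After the last entry only one separator is left, but the parsing asks for two.
      trace-continues ε fin pi pj ρ t t′ r xs (x ∷ _) e t≡ t′≡ split en | _ , refl , eq | p₂ , refl , eq′ =
        ⊥-elim (separator-once i p₂ e eq′)
      trace-continues (s ◅ cs) fin pi pj ρ t t′ r xs (x ∷ _) e t≡ t′≡ split en | _ , refl , eq | p₂ , refl , eq′ =
        trace-continues cs fin (≤-trans (s≤s (total-tail _ s cs)) pi) (≤-trans (s≤s (total-tail _ s cs)) pj)
          ρ t t′ r xs p₂ e t≡ t′≡ eq′ en

    reaches-⇔ : ∀ (ρ : Vec Word m) xs {c} → values ρ xs ≡ encode c →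
                (ρ ⊨ reaches′ xs) ⇔ Reaches c
    reaches-⇔ ρ xs {c} xs≡ = mk⇔ sound complete′
      where
      sound : ρ ⊨ reaches′ xs → Reaches c
      sound (t , t′ , h , (e , r , split , en) , hist) =
        history⇒reaches (h ∷ᵛ t′ ∷ᵛ t ∷ᵛ ρ) (# 2) (# 1) (# 0) hist _ [] e r c ≤-refl split
          (subst (Entry t t′ e) xs≡ en)

      complete′ : Reaches c → ρ ⊨ reaches′ xs
      complete′ (d , cs , fin) =
        power i , power j , [] ⟨ power i ⟩ entry c ⟨ power i ⟩ trace cs ,
        (entry c , trace cs , refl ,
          subst (Entry (power i) (power j) (entry c)) (sym xs≡)
            (entry-valid c (s≤s (head≤total _ cs)) (s≤s (head≤total _ cs)))) ,
        λ p e r x y z split en →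
          trace-continues cs fin ≤-refl ≤-refl
            (z ∷ᵛ y ∷ᵛ x ∷ᵛ r ∷ᵛ e ∷ᵛ p ∷ᵛ _ ∷ᵛ power j ∷ᵛ power i ∷ᵛ ρ)
            (# 8) (# 7) (# 3) (# 2 , # 1 , # 0) p e refl refl split en
        where
        -- `j` is chosen before `i`, because entries contain `power j` and `i` must exceed their
        -- lengths.
        j : ℕ
        j = suc (total size cs)
        i : ℕ
        i = suc (total (λ c → length (join (power j) (encode c))) cs)
        open Completeness i j

  -- A prefix code for letters and states.

  code : ℕ → Word → Word
  code i u = power i ++ β ∷ u

  -- The first `β` ends the block of `α`, so codes can be read off one after another without
  -- separators.
  code-injective : ∀ i j {u v} → code i u ≡ code j v → i ≡ j × u ≡ v
  code-injective zero    zero    refl = refl , refl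
  code-injective zero    (suc j) eq   = ⊥-elim (α≢β (sym (proj₁ (∷-injective eq))))
  code-injective (suc i) zero    eq   = ⊥-elim (α≢β (proj₁ (∷-injective eq)))
  code-injective (suc i) (suc j) eq with code-injective i j (∷-injectiveʳ eq)
  ... | refl , refl = refl , refl

  code′ : ℕ → Term X m → Term X m
  code′ zero    u = const β ∙′ u
  code′ (suc i) u = const α ∙′ code′ i u

  ⟦code′⟧ : ∀ i (u : Term X m) ρ → ⟦ code′ i u ⟧ ρ ≡ code i (⟦ u ⟧ ρ)
  ⟦code′⟧ zero    u ρ = refl
  ⟦code′⟧ (suc i) u ρ = cong (α ∷_) (⟦code′⟧ i u ρ)

  -- Finite disjunctions.

  ⊥′ : Formula X m
  ⊥′ = ¬′ (ε′ ≐ ε′)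

  module _ {b} {A : Set b} where

    ⋁ : List A → (A → Formula X m) → Formula X m
    ⋁ []       φ = ⊥′
    ⋁ (x ∷ xs) φ = φ x ∨′ ⋁ xs φ

    ⋁-elim : ∀ {ρ : Vec Word m} xs φ → ρ ⊨ ⋁ xs φ → Σ A λ x → ρ ⊨ φ x
    ⋁-elim []       φ absurd     = ⊥-elim (absurd refl)
    ⋁-elim (x ∷ xs) φ (inj₁ sat) = x , sat
    ⋁-elim (x ∷ xs) φ (inj₂ sat) = ⋁-elim xs φ sat

    ⋁-intro : ∀ {ρ : Vec Word m} {x xs} φ → x ∈ˡ xs → ρ ⊨ φ x → ρ ⊨ ⋁ xs φ
    ⋁-intro φ (here refl) sat = inj₁ sat
    ⋁-intro φ (there x∈)  sat = inj₂ (⋁-intro φ x∈ sat)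

  -- Turing machines and their snapshots.

  module Simulation (T : TuringMachine X)
    (letters : Enumeration (Symbol X (TuringMachine.auxiliary T))) where

    open TuringMachine T

    controls : Enumeration State
    controls = finEnumeration states

    codeˢ : Letter → Word → Word
    codeˢ s = code (position letters s)

    codeᵠ : State → Word → Word
    codeᵠ q = code (position controls q)

    codeˢ′ : Letter → Term X m → Term X m
    codeˢ′ s = code′ (position letters s)

    codeᵠ′ : State → Term X m → Term X m
    codeᵠ′ q = code′ (position controls q)

    codes : List Letter → Word
    codes = foldr codeˢ []

    codeˢ-injective : ∀ {r s u v} → codeˢ r u ≡ codeˢ s v → r ≡ s × u ≡ v
    codeˢ-injective eq with code-injective _ _ eq
    ... | pos , u≡v = position-injective letters pos , u≡v

    codeᵠ-injective : ∀ {p q u v} → codeᵠ p u ≡ codeᵠ q v → p ≡ q × u ≡ v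
    codeᵠ-injective eq with code-injective _ _ eq
    ... | pos , u≡v = position-injective controls pos , u≡v

    -- A half tape whose far part is input that the head has not yet visited
    -- keeps that part uncoded; hence the input need not be encoded by a formula.

    HalfTape : Set a
    HalfTape = List Letter × Word

    cells : HalfTape → List Letter
    cells (us , v) = us ++ map input v

    pop : HalfTape → Letter × HalfTape
    pop ([]     , [])    = blank   , [] , []
    pop ([]     , x ∷ v) = input x , [] , v
    pop (u ∷ us , v)     = u       , us , v

    -- The head starts on the first input letter, so unvisited input lies only to its right and
    -- `behind` can be coded in full.
    record Snapshot : Set a where
      constructor snapshot
      field
        state   : State
        behind  : List Letter
        scanned : Letter
        ahead   : HalfTape

    config : Snapshot → Config
    config (snapshot q ls s rs) = ⟨ q ∣ cells (ls , []) , s , cells rs ⟩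

    -- State, scanned letter and left cells share one word, since their codes delimit themselves.
    encode : Snapshot → Triple
    encode (snapshot q ls s (us , v)) = codeᵠ q (codeˢ s (codes ls)) , codes us , v

    shift : Direction → State → List Letter → Letter → HalfTape → Snapshot
    shift left  q ls s (us , v) = let (l , ls′ , _) = pop (ls , []) in snapshot q ls′ l (s ∷ us , v)
    shift right q ls s rs       = let (r , rs′) = pop rs in snapshot q (s ∷ ls) r rs′

    move-config : ∀ d q ls s rs → move d q (cells (ls , [])) s (cells rs) ≡ config (shift d q ls s rs)
    move-config left  q []       s rs               = refl
    move-config left  q (l ∷ ls) s rs               = refl
    move-config right q ls       s ([]     , [])    = refl
    move-config right q ls       s ([]     , x ∷ v) = refl
    move-config right q ls       s (u ∷ us , v)     = refl

    data _⇝_ : Snapshot → Snapshot → Set a where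
      fire : ∀ {q ls s rs q′ s′ d} → δ q s ≡ just (q′ , s′ , d) →
             snapshot q ls s rs ⇝ shift d q′ ls s′ rs

    Final : Snapshot → Set
    Final c = Snapshot.state c ∈ accepting

    ⇝⇒⟶ : ∀ {c d} → Star _⇝_ c d → Star _⟶_ (config c) (config d)
    ⇝⇒⟶ ε = ε
    ⇝⇒⟶ (fire {q} {ls} {s} {rs} {q′} {s′} {d} eq ◅ run) =
      subst (_ ⟶_) (move-config d q′ ls s′ rs) (step eq) ◅ ⇝⇒⟶ run

    -- A configuration can have several snapshots, so the run is lifted step by step from the given
    -- one.
    ⟶⇒⇝ : ∀ {c e} → Star _⟶_ (config c) e → Σ Snapshot λ d → e ≡ config d × Star _⇝_ c d
    ⟶⇒⇝ ε = _ , refl , ε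
    ⟶⇒⇝ {snapshot q ls s rs} (step {q′ = q′} {s′} {d} eq ◅ run)
      rewrite move-config d q′ ls s′ rs with ⟶⇒⇝ {shift d q′ ls s′ rs} run
    ... | e , refl , run′ = e , refl , fire eq ◅ run′

    -- Formulas for one machine step.

    unread′ : Letter → (w w′ : Term X m) → Formula X m
    unread′ blank     w w′ = w ≐ ε′ ∧′ w′ ≐ ε′
    unread′ (input x) w w′ = w ≐ const x ∙′ w′
    unread′ (aux i)   w w′ = ⊥′

    pop′ : Letter → (u w u′ w′ : Term X m) → Formula X m
    pop′ s u w u′ w′ = (u ≐ codeˢ′ s u′ ∧′ w ≐ w′) ∨′ (u ≐ ε′ ∧′ u′ ≐ ε′ ∧′ unread′ s w w′)

    -- Every letter code contains a `β`, so a coded part is empty only when it has no cells; this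
    -- decides between the disjuncts of `pop′`.
    pop′-elim : ∀ {ρ : Vec Word m} s (u w u′ w′ : Term X m) us v →
      ⟦ u ⟧ ρ ≡ codes us → ⟦ w ⟧ ρ ≡ v → ρ ⊨ pop′ s u w u′ w′ →
      let (s′ , us′ , v′) = pop (us , v) in s ≡ s′ × ⟦ u′ ⟧ ρ ≡ codes us′ × ⟦ w′ ⟧ ρ ≡ v′
    pop′-elim {ρ = ρ} s u w u′ w′ (_ ∷ us) v u≡ w≡ (inj₁ (eq , w≡w′))
      with codeˢ-injective (trans (sym (⟦code′⟧ _ u′ ρ)) (trans (sym eq) u≡))
    ... | s≡ , u′≡ = s≡ , u′≡ , trans (sym w≡w′) w≡
    pop′-elim {ρ = ρ} s u w u′ w′ [] v u≡ w≡ (inj₁ (eq , _)) =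
      ⊥-elim (letter-occurs (power (position letters s)) (trans (sym u≡) (trans eq (⟦code′⟧ _ u′ ρ))))
    pop′-elim s u w u′ w′ (t ∷ us) v u≡ w≡ (inj₂ (eq , _)) =
      ⊥-elim (letter-occurs (power (position letters t)) (trans (sym eq) u≡))
    pop′-elim blank     u w u′ w′ [] v u≡ refl (inj₂ (_ , u′≡ , w≡[] , w′≡[])) rewrite w≡[] =
      refl , u′≡ , w′≡[]
    pop′-elim (input x) u w u′ w′ [] v u≡ refl (inj₂ (_ , u′≡ , w≡x∷)) rewrite w≡x∷ =
      refl , u′≡ , refl
    pop′-elim (aux i)   u w u′ w′ [] v u≡ w≡ (inj₂ (_ , _ , absurd)) = ⊥-elim (absurd refl)

    pop′-intro : ∀ {ρ : Vec Word m} (u w u′ w′ : Term X m) us v →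
      let (s , us′ , v′) = pop (us , v) in
      ⟦ u ⟧ ρ ≡ codes us → ⟦ w ⟧ ρ ≡ v → ⟦ u′ ⟧ ρ ≡ codes us′ → ⟦ w′ ⟧ ρ ≡ v′ →
      ρ ⊨ pop′ s u w u′ w′
    pop′-intro u w u′ w′ []       []      u≡ w≡ u′≡ w′≡ = inj₂ (u≡ , u′≡ , w≡ , w′≡)
    pop′-intro u w u′ w′ []       (x ∷ v) u≡ w≡ u′≡ w′≡ =
      inj₂ (u≡ , u′≡ , trans w≡ (cong (x ∷_) (sym w′≡)))
    pop′-intro {ρ = ρ} u w u′ w′ (s ∷ us) v u≡ w≡ u′≡ w′≡ =
      inj₁ (trans u≡ (trans (cong (codeˢ s) (sym u′≡)) (sym (⟦code′⟧ _ u′ ρ))) , trans w≡ (sym w′≡))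

    control′ : State → Letter → Fin m → Fin m → Formula X m
    control′ q s x y = var x ≐ codeᵠ′ q (codeˢ′ s (var y))

    control′-elim : ∀ (ρ : Vec Word m) p r x y {q s u} → lookupᵛ ρ x ≡ codeᵠ q (codeˢ s u) →
      ρ ⊨ control′ p r x y → p ≡ q × r ≡ s × lookupᵛ ρ y ≡ u
    control′-elim ρ p r x y x≡ sat
      with codeᵠ-injective (trans (trans (cong (codeᵠ p) (sym (⟦code′⟧ _ (var y) ρ)))
             (sym (⟦code′⟧ _ _ ρ))) (trans (sym sat) x≡))
    ... | p≡q , rest with codeˢ-injective rest
    ...   | r≡s , y≡ = p≡q , r≡s , y≡

    control′-value : ∀ (ρ : Vec Word m) q s (y : Term X m) →
      ⟦ codeᵠ′ q (codeˢ′ s y) ⟧ ρ ≡ codeᵠ q (codeˢ s (⟦ y ⟧ ρ))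
    control′-value ρ q s y = trans (⟦code′⟧ _ _ ρ) (cong (codeᵠ q) (⟦code′⟧ _ y ρ))

    -- The disjunction guesses the letter scanned after the move, and `pop′` confirms it. The
    -- outermost bound word codes the left cells before the move.
    fire′ : State → Letter → Maybe (State × Letter × Direction) → Vars m → Vars m → Formula X m
    fire′ q s nothing                  xs            ys            = ⊥′
    fire′ q s (just (q′ , s′ , left))  (x , u , w) (x′ , u′ , w′) =
      ⋁ (elements letters) λ l → ∃′ ∃′
        (control′ q s (2 ↑ʳ x) (# 1) ∧′
         -- No raw input lies on the left, hence `ε′`: beyond the coded cells comes a blank.
         pop′ l (var (# 1)) ε′ (var (# 0)) ε′ ∧′
         control′ q′ l (2 ↑ʳ x′) (# 0) ∧′
         var (2 ↑ʳ u′) ≐ codeˢ′ s′ (var (2 ↑ʳ u)) ∧′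
         var (2 ↑ʳ w′) ≐ var (2 ↑ʳ w))
    fire′ q s (just (q′ , s′ , right)) (x , u , w) (x′ , u′ , w′) =
      ⋁ (elements letters) λ r → ∃′
        (control′ q s (1 ↑ʳ x) (# 0) ∧′
         pop′ r (var (1 ↑ʳ u)) (var (1 ↑ʳ w)) (var (1 ↑ʳ u′)) (var (1 ↑ʳ w′)) ∧′
         var (1 ↑ʳ x′) ≐ codeᵠ′ q′ (codeˢ′ r (codeˢ′ s′ (var (# 0)))))

    step′ : Vars m → Vars m → Formula X m
    step′ xs ys = ⋁ (elements controls) λ q → ⋁ (elements letters) λ s → fire′ q s (δ q s) xs ys

    values-≡ : ∀ {x y z x′ y′ z′ : Word} → x ≡ x′ → y ≡ y′ → z ≡ z′ → (x , y , z) ≡ (x′ , y′ , z′)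
    values-≡ refl refl refl = refl

    fire-elim : ∀ (ρ : Vec Word m) xs ys {c} p r i → δ p r ≡ i → values ρ xs ≡ encode c →
      ρ ⊨ fire′ p r i xs ys → Σ Snapshot λ d → values ρ ys ≡ encode d × c ⇝ d
    fire-elim ρ xs ys p r nothing δ≡ xs≡ absurd = ⊥-elim (absurd refl)
    fire-elim ρ xs ys {snapshot q ls s rs} p r (just (q′ , s′ , left)) δ≡ xs≡ sat
      with ⋁-elim (elements letters) _ sat
    ... | l , y , y′ , ctl , popped , ctl′ , u′≡ , w′≡
      with control′-elim (y′ ∷ᵛ y ∷ᵛ ρ) p r (2 ↑ʳ proj₁ xs) (# 1) (cong proj₁ xs≡) ctl
    ... | refl , refl , y≡
      with pop′-elim {ρ = y′ ∷ᵛ y ∷ᵛ ρ} l (var (# 1)) ε′ (var (# 0)) ε′ ls [] y≡ refl popped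
    ... | refl , y′≡ , _ = _ , values-≡
      (trans ctl′ (trans (control′-value (y′ ∷ᵛ y ∷ᵛ ρ) q′ l (var (# 0)))
        (cong (λ v → codeᵠ q′ (codeˢ l v)) y′≡)))
      (trans u′≡ (trans (⟦code′⟧ _ _ _) (cong (λ t → codeˢ s′ (second t)) xs≡)))
      (trans w′≡ (cong third xs≡)) , fire δ≡
    fire-elim ρ xs@(x , u , w) ys@(x′ , u′ , w′) {snapshot q ls s (us , v)} p r
      (just (q′ , s′ , right)) δ≡ xs≡ sat
      with ⋁-elim (elements letters) _ sat
    ... | l , y , ctl , popped , x′≡
      with control′-elim (y ∷ᵛ ρ) p r (1 ↑ʳ x) (# 0) (cong proj₁ xs≡) ctl
    ... | refl , refl , y≡
      with pop′-elim {ρ = y ∷ᵛ ρ} l (var (1 ↑ʳ u)) (var (1 ↑ʳ w)) (var (1 ↑ʳ u′)) (var (1 ↑ʳ w′))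
             us v (cong second xs≡) (cong third xs≡) popped
    ... | refl , u′≡ , w′≡ = _ , values-≡
      (trans x′≡ (trans (control′-value (y ∷ᵛ ρ) q′ l (codeˢ′ s′ (var (# 0))))
        (cong (λ t → codeᵠ q′ (codeˢ l t)) (trans (⟦code′⟧ _ _ _) (cong (codeˢ s′) y≡)))))
      u′≡ w′≡ , fire δ≡

    fire-intro : ∀ (ρ : Vec Word m) xs ys {q ls s rs q′ s′} d →
      values ρ xs ≡ encode (snapshot q ls s rs) → values ρ ys ≡ encode (shift d q′ ls s′ rs) →
      ρ ⊨ fire′ q s (just (q′ , s′ , d)) xs ys
    fire-intro ρ xs ys {q} {ls} {s} {rs} {q′} {s′} left xs≡ ys≡ =
      ⋁-intro _ (complete letters l)
        (codes ls , codes ls′ ,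
         trans (cong proj₁ xs≡) (sym (control′-value ρ″ q s (var (# 1)))) ,
         pop′-intro {ρ = ρ″} (var (# 1)) ε′ (var (# 0)) ε′ ls [] refl refl refl (sym (unread-[] ls)) ,
         trans (cong proj₁ ys≡) (sym (control′-value ρ″ q′ l (var (# 0)))) ,
         trans (cong second ys≡)
           (trans (cong (λ t → codeˢ s′ (second t)) (sym xs≡)) (sym (⟦code′⟧ _ _ ρ″))) ,
         trans (cong third ys≡) (cong third (sym xs≡)))
      where
      l : Letter
      l = proj₁ (pop (ls , []))
      ls′ : List Letter
      ls′ = proj₁ (proj₂ (pop (ls , [])))
      ρ″ : Vec Word _
      ρ″ = codes ls′ ∷ᵛ codes ls ∷ᵛ ρ

      unread-[] : ∀ us → proj₂ (proj₂ (pop (us , []))) ≡ []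
      unread-[] []       = refl
      unread-[] (u ∷ us) = refl
    fire-intro ρ xs@(x , u , w) ys@(x′ , u′ , w′) {q} {ls} {s} {us , v} {q′} {s′} right xs≡ ys≡ =
      ⋁-intro _ (complete letters r)
        (codes ls ,
         trans (cong proj₁ xs≡) (sym (control′-value ρ′ q s (var (# 0)))) ,
         pop′-intro {ρ = ρ′} (var (1 ↑ʳ u)) (var (1 ↑ʳ w)) (var (1 ↑ʳ u′)) (var (1 ↑ʳ w′)) us v
           (cong second xs≡) (cong third xs≡)
           (cong second ys≡) (cong third ys≡) ,
         trans (cong proj₁ ys≡)
           (trans (cong (λ t → codeᵠ q′ (codeˢ r t)) (sym (⟦code′⟧ _ _ ρ′)))
             (sym (control′-value ρ′ q′ r (codeˢ′ s′ (var (# 0)))))))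
      where
      r : Letter
      r = proj₁ (pop (us , v))
      ρ′ : Vec Word _
      ρ′ = codes ls ∷ᵛ ρ

    step-⇔ : ∀ (ρ : Vec Word m) xs ys {c} → values ρ xs ≡ encode c →
      (ρ ⊨ step′ xs ys) ⇔ (Σ Snapshot λ d → values ρ ys ≡ encode d × c ⇝ d)
    step-⇔ ρ xs ys {c} xs≡ = mk⇔ elim intro
      where
      elim : ρ ⊨ step′ xs ys → Σ Snapshot λ d → values ρ ys ≡ encode d × c ⇝ d
      elim sat with ⋁-elim (elements controls) _ sat
      ... | q , sat′ with ⋁-elim (elements letters) _ sat′
      ...   | s , sat″ = fire-elim ρ xs ys q s (δ q s) refl xs≡ sat″

      intro : (Σ Snapshot λ d → values ρ ys ≡ encode d × c ⇝ d) → ρ ⊨ step′ xs ys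
      intro (_ , ys≡ , fire {q} {ls} {s} {rs} {q′} {s′} {d} δ≡) =
        ⋁-intro _ (complete controls q) (⋁-intro _ (complete letters s)
          (subst (λ i → ρ ⊨ fire′ q s i xs ys) (sym δ≡) (fire-intro ρ xs ys d xs≡ ys≡)))

    -- Acceptance and the initial configuration.

    accept′ : Vars m → State → Formula X m
    -- Membership in `accepting` is decided while the formula is built; the formula only reads the
    -- state at the start of the first word.
    accept′ (x , _ , _) q with q ∈? accepting
    ... | yes _ = ∃′ (var (1 ↑ʳ x) ≐ codeᵠ′ q (var (# 0)))
    ... | no  _ = ⊥′

    final′ : Vars m → Formula X m
    final′ xs = ⋁ (elements controls) (accept′ xs)

    final-⇔ : ∀ (ρ : Vec Word m) xs {c} → values ρ xs ≡ encode c → (ρ ⊨ final′ xs) ⇔ Final c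
    final-⇔ ρ xs {c} xs≡ = mk⇔ elim
      (λ q∈ → ⋁-intro (accept′ xs) (complete controls (Snapshot.state c)) (intro q∈))
      where
      accepted : ∀ q → ρ ⊨ accept′ xs q → Final c
      accepted q sat with q ∈? accepting
      accepted q absurd     | no _   = ⊥-elim (absurd refl)
      accepted q (y , x≡)   | yes q∈
        with codeᵠ-injective {q} (trans (sym (⟦code′⟧ (position controls q) (var (# 0)) (y ∷ᵛ ρ)))
               (trans (sym x≡) (cong proj₁ xs≡)))
      ... | refl , _ = q∈

      elim : ρ ⊨ final′ xs → Final c
      elim sat with ⋁-elim (elements controls) _ sat
      ... | q , sat′ = accepted q sat′

      intro : Final c → ρ ⊨ accept′ xs (Snapshot.state c)
      intro q∈ with Snapshot.state c ∈? accepting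
      ... | no  q∉ = ⊥-elim (q∉ q∈)
      ... | yes _  = _ , trans (cong proj₁ xs≡) (sym (⟦code′⟧ _ (var (# 0)) (_ ∷ᵛ ρ)))

    open Reachability _⇝_ Final encode step′ final′ step-⇔ final-⇔

    load : Word → Snapshot
    load w = let (s , rs) = pop ([] , w) in snapshot start [] s rs

    load-config : ∀ w → initial w ≡ config (load w)
    load-config []      = refl
    load-config (x ∷ w) = refl

    accepts⇔reaches : ∀ w → Accepts w ⇔ Reaches (load w)
    accepts⇔reaches w = mk⇔ to from
      where
      to : Accepts w → Reaches (load w)
      to (q , ls , s , rs , run , q∈)
        with ⟶⇒⇝ (subst (λ c → Star _⟶_ c _) (load-config w) run)
      ... | d , refl , run′ = d , run′ , q∈

      from : Reaches (load w) → Accepts w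
      from (d , run , q∈) =
        _ , _ , _ , _ , subst (λ c → Star _⟶_ c (config d)) (sym (load-config w)) (⇝⇒⟶ run) , q∈

    -- Loading the input is popping from a half tape with no coded cells and raw part `w`.
    accepts′ : Formula X 1
    accepts′ = ∃′ ∃′ ∃′
      ((⋁ (elements letters) λ s →
          var (# 2) ≐ codeᵠ′ start (codeˢ′ s ε′) ∧′
          pop′ s ε′ (var (# 3)) (var (# 1)) (var (# 0))) ∧′
       reaches′ (# 2 , # 1 , # 0))

    accepts-⇔ : ∀ w → Accepts w ⇔ (w ∷ᵛ []ᵛ ⊨ accepts′)
    accepts-⇔ w = mk⇔ to from
      where
      to : Accepts w → w ∷ᵛ []ᵛ ⊨ accepts′
      to acc = let c = load w ; (x , u , v) = encode c ; ρ = v ∷ᵛ u ∷ᵛ x ∷ᵛ w ∷ᵛ []ᵛ in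
        x , u , v ,
        ⋁-intro _ (complete letters (Snapshot.scanned c))
          (sym (control′-value ρ start _ ε′) ,
           pop′-intro {ρ = ρ} ε′ (var (# 3)) (var (# 1)) (var (# 0)) [] w refl refl refl refl) ,
        Equivalence.from (reaches-⇔ ρ (# 2 , # 1 , # 0) refl) (Equivalence.to (accepts⇔reaches w) acc)

      from : w ∷ᵛ []ᵛ ⊨ accepts′ → Accepts w
      from (x , u , v , init , reach) with ⋁-elim (elements letters) _ init
      ... | s , x≡ , popped
        with pop′-elim {ρ = v ∷ᵛ u ∷ᵛ x ∷ᵛ w ∷ᵛ []ᵛ} s ε′ (var (# 3)) (var (# 1)) (var (# 0)) [] w refl refl popped
      ... | refl , u≡ , v≡ = Equivalence.from (accepts⇔reaches w)
        (Equivalence.to (reaches-⇔ (v ∷ᵛ u ∷ᵛ x ∷ᵛ w ∷ᵛ []ᵛ) (# 2 , # 1 , # 0)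
          (values-≡ (trans x≡ (control′-value (v ∷ᵛ u ∷ᵛ x ∷ᵛ w ∷ᵛ []ᵛ) start s ε′)) u≡ v≡)) reach)

theorem5 : ∀ {a ℓ} {X : Set a} {n : ℕ} → X ↔ Fin n → 2 ≤ n →
    (L : Pred (List X) ℓ) → RecursivelyEnumerable L → Definable (++-monoid X) [_] L
theorem5 {n = suc (suc n)} X↔Fin (s≤s (s≤s _)) L (T , L⇔T) =
  accepts′ , λ w → accepts-⇔ w ⇔-∘ L⇔T w
  where
  open Inverse X↔Fin

  -- The roles of `α` and `β` go to the letters numbered zero and one.
  distinct : from zero ≢ from (suc zero)
  distinct eq with trans (sym (strictlyInverseˡ zero)) (trans (cong to eq) (strictlyInverseˡ (suc zero)))
  ... | ()

  open FreeMonoid.Simulation distinct T (symbolEnumeration X↔Fin (TuringMachine.auxiliary T))
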